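{- Let $X$ be a homogeneously self-similar graph with constant inner degree $b$. Then, for every positive integer $n$ and every $n$-cell $C_n$, $$|\delta C_n|=\Big(\frac{b}{\theta_X-1}\Big)^{n-1}\delta_X .$$
   Context: Graph $X$ with vertex set $VX$ and edge set $EX$ is connected, locally finite, infinite, without loops or multiple edges. $d_X$ is the graph distance and $\deg_X x$ the number of neighbours of $x$ in $X$. For $C\subset VX$, the boundary $\theta C$ is the set of vertices in $VX\setminus C$ adjacent to some vertex of $C$; the closure is $\overline{C}=C\cup\theta C$; $\hat C$ is the subgraph of $X$ spanned (induced) by $\overline{C}$; the edge boundary $\delta C$ is the set of edges connecting a vertex in $C$ with a vertex in $VX\setminus C$. For $F\subset VX$, $\mathcal{C}_XF$ denotes the set of connected components of $VX\setminus F$ (as vertex sets). The reduced graph $X_F$ has vertex set $F$, and two (distinct) vertices $x,y\in F$ are adjacent in $X_F$ iff there is $C\in\mathcal{C}_XF$ with $x,y\in\theta C$. $X$ is self-similar with respect to $F\subset VX$ and $\psi:VX\to F$ if: (F1) no two vertices of $F$ are adjacent in $X$; (F2) the intersection of the closures of two different components in $\mathcal{C}_XF$ contains at most one vertex; (F3) $\psi$ is a graph isomorphism from $X$ to $X_F$. Put $F^0=VX$, $F^n=\psi^n(VX)$ (so $F^1=F$). Elements of $\mathcal{C}_XF^n$ are called $n$-cells; $1$-cells are called cells. A self-similar graph $X$ is homogeneously self-similar if: (H1) all cell graphs $\hat C$ ($C\in\mathcal{C}_XF$) are finite and for any cells $C,D$ there is a graph isomorphism $\alpha:\hat C\to\hat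 D$ with $\alpha(\theta C)=\theta D$; (H2) for every cell $C$ and $v_1,v_2,v_3,v_4\in\theta C$ with $v_1\neq v_2$, $v_3\ne v_4$, one has $d_X(v_1,v_2)=d_X(v_3,v_4)$. Put $\theta_X=|\theta C|$ and $\delta_X=|\delta C|$ for a cell $C$ (independent of the choice of $C$). A number $b$ is a constant inner degree of $X$ if $b=\deg_{\hat C}v$ for every cell $C$ and every $v\in\theta C$. -}

module Defs where

open import Algebra.Definitions.RawSemiring using () renaming (_^_ to power)
open import Data.List using (List; length)
open import Data.List.Membership.Propositional using () renaming (_∈_ to _∈ₗ_)
open import Data.List.Relation.Unary.Unique.Propositional using (Unique)
open import Data.Nat using (ℕ; zero; suc; _≤_)
open import Data.Product using (Σ-syntax; ∃-syntax; _×_; _,_)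
open import Data.Rational.Base using (ℚ; +-*-rawSemiring)
open import Function.Bundles using (_⇔_)
open import Level using (Level; 0ℓ; _⊔_) renaming (suc to lsuc)
open import Relation.Binary.Construct.Closure.ReflexiveTransitive using (Star; fold)
open import Relation.Binary.Core using (Rel)
open import Relation.Binary.Definitions using (Symmetric)
open import Relation.Binary.PropositionalEquality using (_≡_; _≢_)
open import Relation.Nullary using (¬_)
open import Relation.Unary using (Pred; U; _∈_; _∉_; _∩_; _∪_; _≐_)

private
  variable
    a ℓ ℓ₁ ℓ₂ : Level
    A : Set a

infixr 8 _^_
_^_ : ℚ → ℕ → ℚ
_^_ = power +-*-rawSemiring

-- A repetition-free enumeration. Counting elements rather than proofs of
-- membership, it does not depend on P being proof-irrelevant.
record HasSize {A : Set a} (P : Pred A ℓ) (k : ℕ) : Set (a ⊔ ℓ) where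
  field
    elements : List A
    unique   : Unique elements
    complete : ∀ x → x ∈ₗ elements ⇔ x ∈ P
    size     : length elements ≡ k

Finite : {A : Set a} → Pred A ℓ → Set _
Finite P = ∃[ k ] HasSize P k

image : {A : Set} → (A → A) → Pred A 0ℓ → Pred A 0ℓ
image f P y = ∃[ x ] x ∈ P × f x ≡ y

-- A graph whose vertices form a subset of A; adjacency is only meaningful
-- between elements of that subset.
record GraphOn (A : Set) (ℓ : Level) : Set (lsuc ℓ) where
  field
    vertices : Pred A 0ℓ
    adjacent : Rel A ℓ

open GraphOn public

-- f is a total function on A, but only its values on the vertices of G matter.
record IsIsomorphism {A : Set} (G : GraphOn A ℓ₁) (H : GraphOn A ℓ₂)
                     (f : A → A) : Set (ℓ₁ ⊔ ℓ₂) where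
  field
    maps       : ∀ {x} → x ∈ vertices G → f x ∈ vertices H
    injective  : ∀ {x y} → x ∈ vertices G → y ∈ vertices G → f x ≡ f y → x ≡ y
    surjective : ∀ {y} → y ∈ vertices H → ∃[ x ] x ∈ vertices G × f x ≡ y
    adjacency  : ∀ {x y} → x ∈ vertices G → y ∈ vertices G →
                 adjacent G x y ⇔ adjacent H (f x) (f y)

HasDegree : {A : Set} → GraphOn A ℓ → A → ℕ → Set ℓ
HasDegree G v k = HasSize (adjacent G v) k

record Graph : Set₁ where
  infix 4 _~_
  field
    V             : Set
    _~_           : Rel V 0ℓ
    ~-sym         : Symmetric _~_
    ~-irrefl      : ∀ {x} → ¬ (x ~ x)
    connected     : ∀ x y → Star _~_ x y
    locallyFinite : ∀ x → Finite (x ~_)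
    infinite      : ¬ Finite {A = V} U

module _ (X : Graph) where
  open Graph X

  whole : GraphOn V 0ℓ
  whole = record { vertices = U ; adjacent = _~_ }

  walkLength : ∀ {x y} → Star _~_ x y → ℕ
  walkLength = fold (λ _ _ → ℕ) (λ _ → suc) 0

  IsDistance : V → V → ℕ → Set
  IsDistance x y d = (Σ[ w ∈ Star _~_ x y ] walkLength w ≡ d) ×
                     (∀ (w : Star _~_ x y) → d ≤ walkLength w)

  θ : Pred V 0ℓ → Pred V 0ℓ
  θ C y = y ∉ C × ∃[ x ] x ∈ C × x ~ y

  closure : Pred V 0ℓ → Pred V 0ℓ
  closure C = C ∪ θ C

  hull : Pred V 0ℓ → GraphOn V 0ℓ
  hull C = record
    { vertices = closure C
    ; adjacent = λ x y → x ∈ closure C × y ∈ closure C × x ~ y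
    }

  -- Each edge between C and its complement has exactly one endpoint in C, so
  -- it is represented once, as the pair (inner endpoint , outer endpoint).
  δ : Pred V 0ℓ → Pred (V × V) 0ℓ
  δ C (x , y) = x ∈ C × y ∉ C × x ~ y

  AdjacentOutside : Pred V 0ℓ → Rel V 0ℓ
  AdjacentOutside F x y = x ∉ F × y ∉ F × x ~ y

  -- Subsets of V are compared extensionally, so a component is any predicate
  -- equivalent to a reachability class of the complement of F.
  𝒞 : Pred V 0ℓ → Pred (Pred V 0ℓ) 0ℓ
  𝒞 F C = ∃[ v ] v ∉ F × C ≐ Star (AdjacentOutside F) v

  reduced : Pred V 0ℓ → GraphOn V (lsuc 0ℓ)
  reduced F = record
    { vertices = F
    ; adjacent = λ x y → x ∈ F × y ∈ F × x ≢ y ×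
                   (Σ[ C ∈ Pred V 0ℓ ] C ∈ 𝒞 F × x ∈ θ C × y ∈ θ C)
    }

  record IsSelfSimilar (F : Pred V 0ℓ) (ψ : V → V) : Set₁ where
    field
      F1 : ∀ {x y} → x ∈ F → y ∈ F → ¬ (x ~ y)
      F2 : ∀ {C D} → C ∈ 𝒞 F → D ∈ 𝒞 F → ¬ (C ≐ D) →
           ∀ {x y} → x ∈ closure C ∩ closure D → y ∈ closure C ∩ closure D → x ≡ y
      F3 : IsIsomorphism whole (reduced F) ψ

  record IsHomogeneouslySelfSimilar (F : Pred V 0ℓ) (ψ : V → V) : Set₁ where
    field
      selfSimilar : IsSelfSimilar F ψ
      H1-finite   : ∀ {C} → C ∈ 𝒞 F → Finite (closure C)
      H1-iso      : ∀ {C D} → C ∈ 𝒞 F → D ∈ 𝒞 F →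
                    ∃[ α ] IsIsomorphism (hull C) (hull D) α × image α (θ C) ≐ θ D
      H2          : ∀ {C} → C ∈ 𝒞 F → ∀ {v₁ v₂ v₃ v₄} →
                    v₁ ∈ θ C → v₂ ∈ θ C → v₃ ∈ θ C → v₄ ∈ θ C →
                    v₁ ≢ v₂ → v₃ ≢ v₄ →
                    ∀ {d e} → IsDistance v₁ v₂ d → IsDistance v₃ v₄ e → d ≡ e

  HasConstantInnerDegree : Pred V 0ℓ → ℕ → Set₁
  HasConstantInnerDegree F b =
    ∀ {C} → C ∈ 𝒞 F → ∀ {v} → v ∈ θ C → HasDegree (hull C) v b

  iterImage : (V → V) → ℕ → Pred V 0ℓ
  iterImage ψ zero    = U
  iterImage ψ (suc n) = image ψ (iterImage ψ n)

  IsNCell : (V → V) → ℕ → Pred (Pred V 0ℓ) 0ℓ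
  IsNCell ψ n = 𝒞 (iterImage ψ n)

-- An (n+1)-cell E meets F in ψ D for an n-cell D. Through ψ, the edges leaving D are the pairs
-- of distinct vertices of some θ K, K a cell, whose second vertex lies in F^(n+1); an edge
-- leaving E joins such a second vertex to K. For a given K and second vertex there are θX ∸ 1
-- such pairs and b such edges, so double counting yields |δ E| (θX ∸ 1) = |δ D| b.
module Submission where

open import Defs
open import Axiom.ExcludedMiddle using (ExcludedMiddle)
open import Data.Empty using (⊥-elim)
open import Data.Integer using (+_)
import Data.Integer as ℤ
import Data.Integer.Properties as ℤ
open import Data.List using (List; []; _∷_; _++_; map; length; filter; deduplicate)
open import Data.List.Membership.Propositional using () renaming (_∈_ to _∈ₗ_)
open import Data.List.Membership.Propositional.Properties
  using (∈-map⁺; ∈-map⁻; ∈-++⁺ˡ; ∈-++⁺ʳ; ∈-++⁻; ∈-filter⁺; ∈-filter⁻; ∈-deduplicate⁺)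
open import Data.List.Membership.Propositional.Properties.WithK using (unique∧set⇒bag)
open import Data.List.Properties using (length-map; length-++)
open import Data.List.Relation.Binary.BagAndSetEquality using (∼bag⇒↭)
open import Data.List.Relation.Binary.Permutation.Propositional.Properties using (↭-length)
open import Data.List.Relation.Unary.All using (All; []; _∷_; tabulate)
open import Data.List.Relation.Unary.AllPairs using ([]; _∷_)
open import Data.List.Relation.Unary.Any using (here; there)
open import Data.List.Relation.Unary.Unique.DecPropositional.Properties using (deduplicate-!)
open import Data.List.Relation.Unary.Unique.Propositional using (Unique)
open import Data.List.Relation.Unary.Unique.Propositional.Properties
  using (map⁻; ++⁺; filter⁺; Unique[x∷xs]⇒x∉xs)
open import Data.Nat using (ℕ; zero; suc; NonZero; _∸_; _≤_; z≤n; s≤s)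
import Data.Nat as ℕ
import Data.Nat.Properties as ℕ
open import Data.Product using (Σ-syntax; ∃-syntax; _×_; _,_; proj₁; proj₂; swap)
open import Data.Rational using (ℚ; _/_; _*_; toℚᵘ)
import Data.Rational.Properties as ℚ
import Data.Rational.Unnormalised as ℚᵘ
import Data.Rational.Unnormalised.Properties as ℚᵘ
open import Data.Sum using (_⊎_; inj₁; inj₂; [_,_]′)
open import Data.Unit using (tt)
open import Function using (_∘_; id)
open import Function.Bundles using (Equivalence; mk⇔)
open import Function.Construct.Composition using (_⇔-∘_)
open import Function.Construct.Symmetry using (⇔-sym)
open import Level using (0ℓ)
open import Relation.Binary.Construct.Closure.ReflexiveTransitive
  using (Star; ε; _◅_; _◅◅_; reverse) renaming (map to Star-map)
open import Relation.Binary.PropositionalEquality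
  using (_≡_; _≢_; refl; sym; trans; cong; cong₂; subst; module ≡-Reasoning)
open import Relation.Nullary using (Dec; yes; no)
open import Relation.Unary using (Pred; _∈_; _∉_; _∪_; _≐_; _⊆_)

open Equivalence using (to; from)

-- Counting by repetition-free enumerations.

private
  variable
    A B : Set
    P Q : Pred A 0ℓ
    k l : ℕ

module _ (s : HasSize {A = A} P k) where
  open HasSize s

  listed : ∀ {x} → x ∈ P → x ∈ₗ elements
  listed = from (complete _)

  unlisted : ∀ {x} → x ∈ₗ elements → x ∈ P
  unlisted = to (complete _)

-- Repetition-free lists with the same members are equal as bags, hence permutations of each other.
HasSize-unique : HasSize P k → HasSize P l → k ≡ l
HasSize-unique s t =
  trans (sym (size s)) (trans (↭-length (∼bag⇒↭ (unique∧set⇒bag (unique s) (unique t)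
    (⇔-sym (complete t _) ⇔-∘ complete s _)))) (size t))
  where open HasSize

-- The enumeration of `Q` is lifted entry by entry to chosen preimages. Applying `f` returns the
-- original list, so the lift has no repetitions; injectivity on `P` makes it complete. All later
-- bijections are counted this way.
HasSize-preimage : (f : A → B) →
  (∀ {a} → a ∈ P → f a ∈ Q) →
  (∀ {a a′} → a ∈ P → a′ ∈ P → f a ≡ f a′ → a ≡ a′) →
  (∀ {b} → b ∈ Q → ∃[ a ] a ∈ P × f a ≡ b) →
  HasSize Q k → HasSize P k
HasSize-preimage {A = A} {P = P} f maps inj surj s
  with preimages (tabulate (surj ∘ unlisted s))
  where
  preimages : ∀ {bs} → All (λ b → ∃[ a ] a ∈ P × f a ≡ b) bs →
              ∃[ as ] (∀ {a} → a ∈ₗ as → a ∈ P) × map f as ≡ bs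
  preimages []                     = [] , (λ ()) , refl
  preimages ((a , p , refl) ∷ pbs) with preimages pbs
  ... | as , ps , refl = a ∷ as , (λ { (here refl) → p ; (there i) → ps i }) , refl
... | as , ps , eq = record
  { elements = as
  ; unique   = map⁻ (subst Unique (sym eq) (HasSize.unique s))
  ; complete = λ a → mk⇔ ps (found a)
  ; size     = trans (sym (length-map f as)) (trans (cong length eq) (HasSize.size s))
  }
  where
  found : ∀ a → a ∈ P → a ∈ₗ as
  found a p with ∈-map⁻ f (subst (f a ∈ₗ_) (sym eq) (listed s (maps p)))
  ... | a′ , i , fa≡fa′ = subst (_∈ₗ as) (sym (inj p (ps i) fa≡fa′)) i

HasSize-resp-≐ : P ≐ Q → HasSize P k → HasSize Q k
HasSize-resp-≐ (P⊆Q , Q⊆P) =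
  HasSize-preimage id Q⊆P (λ _ _ → id) (λ p → _ , P⊆Q p , refl)

HasSize-singleton : (a : A) → HasSize (_≡ a) 1
HasSize-singleton a = record
  { elements = a ∷ []
  ; unique   = [] ∷ []
  ; complete = λ _ → mk⇔ (λ { (here eq) → eq ; (there ()) }) here
  ; size     = refl
  }

HasSize-∪ : (∀ {a} → a ∈ P → a ∉ Q) → HasSize P k → HasSize Q l → HasSize (P ∪ Q) (k ℕ.+ l)
HasSize-∪ disjoint s t = record
  { elements = elements s ++ elements t
  ; unique   = ++⁺ (unique s) (unique t)
                 λ (i , j) → disjoint (unlisted s i) (unlisted t j)
  ; complete = λ _ → mk⇔
      ([ inj₁ ∘ unlisted s , inj₂ ∘ unlisted t ]′ ∘ ∈-++⁻ (elements s))
      [ ∈-++⁺ˡ ∘ listed s , ∈-++⁺ʳ (elements s) ∘ listed t ]′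
  ; size     = trans (length-++ (elements s)) (cong₂ ℕ._+_ (size s) (size t))
  }
  where open HasSize

HasSize-Σ : {R : A → Pred B 0ℓ} → HasSize P k → (∀ {a} → a ∈ P → HasSize (R a) l) →
            HasSize (λ (a , b) → a ∈ P × b ∈ R a) (k ℕ.* l)
HasSize-Σ {A = A} {B = B} {l = l} {R = R} s fibre =
  -- Membership in `P` is traded for membership in its list, so that the count can recurse on the
  -- list.
  HasSize-resp-≐ {P = λ ((a , b) : A × B) → a ∈ₗ HasSize.elements s × b ∈ R a}
    ((λ (i , r) → unlisted s i , r) , (λ (p , r) → listed s p , r))
    (subst (λ k → HasSize _ (k ℕ.* l)) (HasSize.size s)
      (overList (HasSize.unique s) (fibre ∘ unlisted s)))
  where
  overList : ∀ {as} → Unique as → (∀ {a} → a ∈ₗ as → HasSize (R a) l) →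
             HasSize (λ (a , b) → a ∈ₗ as × b ∈ R a) (length as ℕ.* l)
  overList {[]}     _             _  = record
    { elements = []
    ; unique   = []
    ; complete = λ _ → mk⇔ (λ ()) (λ { (() , _) })
    ; size     = refl
    }
  overList {a ∷ as} u@(_ ∷ us) fs = HasSize-resp-≐
    {P = (λ ((x , b) : A × B) → x ≡ a × b ∈ R x) ∪ (λ (x , b) → x ∈ₗ as × b ∈ R x)}
    ( [ (λ { (refl , r) → here refl , r }) , (λ (i , r) → there i , r) ]′
    , (λ { (here eq , r) → inj₁ (eq , r) ; (there i , r) → inj₂ (i , r) }))
    (HasSize-∪ (λ { (refl , _) (i , _) → Unique[x∷xs]⇒x∉xs u i })
      (HasSize-preimage {Q = R a} proj₂
        (λ { (refl , r) → r })
        (λ { (refl , _) (refl , _) refl → refl })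
        (λ r → (a , _) , (refl , r) , refl)
        (fs (here refl)))
      (overList us (fs ∘ there)))

two-elements : HasSize P k → 2 ≤ k → ∃[ x ] ∃[ y ] x ∈ P × y ∈ P × x ≢ y
two-elements s _ with HasSize.elements s | unlisted s | HasSize.unique s | HasSize.size s
two-elements s (s≤s (s≤s _)) | x ∷ y ∷ _ | ∈P | (x≢y ∷ _) ∷ _ | refl =
  x , y , ∈P (here refl) , ∈P (there (here refl)) , x≢y

two-elements⁻ : HasSize P k → ∀ {x y} → x ∈ P → y ∈ P → x ≢ y → 2 ≤ k
two-elements⁻ s p q x≢y with HasSize.elements s | listed s p | listed s q | HasSize.size s
... | _ ∷ []    | here refl | here refl | _    = ⊥-elim (x≢y refl)
... | _ ∷ _ ∷ _ | _         | _         | refl = s≤s (s≤s z≤n)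

nonempty : HasSize P k → .{{NonZero k}} → ∃[ x ] x ∈ P
nonempty {k = suc _} s with HasSize.elements s | unlisted s | HasSize.size s
... | x ∷ _ | ∈P | _ = x , ∈P (here refl)

-- Finite subsets and double counting with excluded middle.

module Classical (em : ExcludedMiddle 0ℓ) where

  finite-⊆-list : ∀ xs → (∀ {x} → x ∈ P → x ∈ₗ xs) → Finite {A = A} P
  finite-⊆-list {P = P} xs P⊆xs = _ , record
    { elements = filter P? (deduplicate _≟_ xs)
    ; unique   = filter⁺ P? (deduplicate-! _≟_ xs)
    ; complete = λ _ → mk⇔ (proj₂ ∘ ∈-filter⁻ P? {xs = deduplicate _≟_ xs})
                           (λ p → ∈-filter⁺ P? (∈-deduplicate⁺ _≟_ (P⊆xs p)) p)
    ; size     = refl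
    }
    where
    P? : ∀ x → Dec (P x)
    P? _ = em
    _≟_ : ∀ x y → Dec (x ≡ y)
    _ ≟ _ = em

  -- `P` splits into the singleton of `a` and a rest of some size `j`. Uniqueness of sizes gives
  -- `1 + j ≡ k`, and `(1 + j) ∸ 1` computes to `j`.
  HasSize-remove : ∀ {a} → a ∈ P → HasSize P k → HasSize (λ x → x ∈ P × x ≢ a) (k ∸ 1)
  HasSize-remove {P = P} {a = a} p s
    with finite-⊆-list {P = λ x → x ∈ P × x ≢ a} (HasSize.elements s) (listed s ∘ proj₁)
  ... | j , t = subst (λ k → HasSize _ (k ∸ 1)) (HasSize-unique (HasSize-resp-≐
      ([ (λ { refl → p }) , proj₁ ]′ , split)
      (HasSize-∪ (λ { refl (_ , a≢a) → a≢a refl }) (HasSize-singleton a) t)) s) t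
    where
    split : ∀ {x} → x ∈ P → x ≡ a ⊎ (x ∈ P × x ≢ a)
    split {x} q with em {x ≡ a}
    ... | yes eq = inj₁ eq
    ... | no neq = inj₂ (q , neq)

  -- The related pairs are enumerated by columns and recounted by rows. Finiteness of `P` is a
  -- conclusion: since `p` is nonzero, each element of `P` has a nonempty row and so occurs in the
  -- list of pairs.
  doubleCount : {P : Pred A 0ℓ} {Q : Pred B 0ℓ} (R : A → Pred B 0ℓ) {p q : ℕ} → .{{NonZero p}} →
    (∀ {a b} → b ∈ R a → a ∈ P × b ∈ Q) →
    (∀ {a} → a ∈ P → HasSize (R a) p) →
    (∀ {b} → b ∈ Q → HasSize (λ a → b ∈ R a) q) →
    HasSize Q l → ∃[ k ] HasSize P k × k ℕ.* p ≡ l ℕ.* q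
  doubleCount {P = P} R sound rows columns t = _ , proj₂ finite ,
    HasSize-unique
      (HasSize-preimage swap swapped₂ (λ { _ _ refl → refl }) (λ r → swap _ , swapped₁ r , refl)
        (HasSize-Σ (proj₂ finite) rows))
      incidences
    where
    incidences = HasSize-Σ {R = λ b a → b ∈ R a} t columns
    finite : Finite P
    finite = finite-⊆-list (map proj₂ (HasSize.elements incidences)) λ a∈P →
      let b , r = nonempty (rows a∈P)
      in ∈-map⁺ proj₂ (listed incidences (proj₂ (sound r) , r))
    swapped₁ : ∀ {a b} → a ∈ P × b ∈ R a → _
    swapped₁ (_ , r) = proj₂ (sound r) , r
    swapped₂ : ∀ {a b} → _ × b ∈ R a → _
    swapped₂ (_ , r) = proj₁ (sound r) , r

-- Components of a complement and their boundaries.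

module _ (X : Graph) where
  open Graph X

  -- For `v` in `F` this is just the singleton of `v`, not an element of `𝒞 X F`; hence the
  -- hypotheses `v ∉ F` below.
  component : Pred V 0ℓ → V → Pred V 0ℓ
  component F = Star (AdjacentOutside X F)

  θ-resp-≐ : ∀ {C D} → C ≐ D → θ X C ⊆ θ X D
  θ-resp-≐ (C⊆D , D⊆C) (y∉C , x , x∈C , x~y) = y∉C ∘ D⊆C , x , C⊆D x∈C , x~y

  δ-resp-≐ : ∀ {C D} → C ≐ D → δ X C ≐ δ X D
  δ-resp-≐ (C⊆D , D⊆C) =
      (λ (x∈C , y∉C , x~y) → C⊆D x∈C , y∉C ∘ D⊆C , x~y)
    , (λ (x∈D , y∉D , x~y) → D⊆C x∈D , y∉D ∘ C⊆D , x~y)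

  module _ {F : Pred V 0ℓ} where

    component-sym : ∀ {x y} → y ∈ component F x → x ∈ component F y
    component-sym = reverse (λ (x∉ , y∉ , x~y) → y∉ , x∉ , ~-sym x~y)

    component-≐ : ∀ {x y} → y ∈ component F x → component F x ≐ component F y
    component-≐ p = component-sym p ◅◅_ , p ◅◅_

    component-∈-𝒞 : ∀ {v} → v ∉ F → component F v ∈ 𝒞 X F
    component-∈-𝒞 v∉F = _ , v∉F , id , id

    component-cong : ∀ {F′ v} → F ≐ F′ → component F v ≐ component F′ v
    component-cong (F⊆F′ , F′⊆F) =
        Star-map (λ (x∉F , y∉F , x~y) → x∉F ∘ F′⊆F , y∉F ∘ F′⊆F , x~y)
      , Star-map (λ (x∉F′ , y∉F′ , x~y) → x∉F′ ∘ F⊆F′ , y∉F′ ∘ F⊆F′ , x~y)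

    component-avoids : ∀ {v x} → v ∉ F → x ∈ component F v → x ∉ F
    component-avoids v∉F ε                   = v∉F
    component-avoids v∉F ((_ , y∉F , _) ◅ p) = component-avoids y∉F p

    component-extend : ∀ {v x y} → v ∉ F → x ∈ component F v → x ~ y → y ∉ F →
                       y ∈ component F v
    component-extend v∉F p x~y y∉F = p ◅◅ (component-avoids v∉F p , y∉F , x~y) ◅ ε

    component-boundary⁺ : ∀ {v x y} → v ∉ F → x ∈ component F v → x ~ y → y ∈ F →
                          y ∈ θ X (component F v)
    component-boundary⁺ v∉F p x~y y∈F = (λ q → component-avoids v∉F q y∈F) , _ , p , x~y

    module _ (em : ExcludedMiddle 0ℓ) where

      component-boundary⁻ : ∀ {v y} → v ∉ F → y ∈ θ X (component F v) → y ∈ F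
      component-boundary⁻ {y = y} v∉F (y∉C , _ , p , x~y) with em {y ∈ F}
      ... | yes y∈F = y∈F
      ... | no  y∉F = ⊥-elim (y∉C (component-extend v∉F p x~y y∉F))

-- Self-similarity: cells, and components before and after `ψ`.

module SelfSimilar (em : ExcludedMiddle 0ℓ) {X : Graph} {F : Pred (Graph.V X) 0ℓ}
                   {ψ : Graph.V X → Graph.V X} (selfSimilar : IsSelfSimilar X F ψ) where
  open Graph X
  open IsSelfSimilar selfSimilar
  open IsIsomorphism F3

  cell : V → Pred V 0ℓ
  cell = component X F

  ψ∈F : ∀ {x} → ψ x ∈ F
  ψ∈F = maps tt

  ψ-injective : ∀ {x y} → ψ x ≡ ψ y → x ≡ y
  ψ-injective = injective tt tt

  θ-cell⊆F : ∀ {v} → v ∉ F → θ X (cell v) ⊆ F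
  θ-cell⊆F v∉F = component-boundary⁻ X em v∉F

  ~⇒shared-cell : ∀ {x y} → x ~ y →
    ψ x ≢ ψ y × ∃[ v ] v ∉ F × ψ x ∈ θ X (cell v) × ψ y ∈ θ X (cell v)
  ~⇒shared-cell x~y with to (adjacency tt tt) x~y
  ... | _ , _ , ψx≢ψy , C , (v , v∉F , C≐) , ψx∈θC , ψy∈θC =
    ψx≢ψy , v , v∉F , θ-resp-≐ X C≐ ψx∈θC , θ-resp-≐ X C≐ ψy∈θC

  shared-cell⇒~ : ∀ {v x y} → v ∉ F → ψ x ∈ θ X (cell v) → ψ y ∈ θ X (cell v) →
                  ψ x ≢ ψ y → x ~ y
  shared-cell⇒~ v∉F ψx∈θ ψy∈θ ψx≢ψy = from (adjacency tt tt)
    (ψ∈F , ψ∈F , ψx≢ψy , _ , component-∈-𝒞 X v∉F , ψx∈θ , ψy∈θ)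

  -- By (F2), closures of different cells meet in at most one vertex, whereas here they share `x`
  -- and `y`.
  shared-cell-unique : ∀ {v w x y} → v ∉ F → w ∉ F → x ≢ y →
    x ∈ θ X (cell v) → y ∈ θ X (cell v) → x ∈ θ X (cell w) → y ∈ θ X (cell w) →
    cell v ≐ cell w
  shared-cell-unique {v} {w} v∉F w∉F x≢y xv yv xw yw with em {cell v ≐ cell w}
  ... | yes eq = eq
  ... | no neq = ⊥-elim (x≢y (F2 (component-∈-𝒞 X v∉F) (component-∈-𝒞 X w∉F) neq
                                 (inj₂ xv , inj₂ xw) (inj₂ yv , inj₂ yw)))

  -- If `v` were isolated, connectedness would leave `v` as the only vertex, against infiniteness.
  edge : V → ∃[ x ] ∃[ y ] x ~ y
  edge v with em {∃[ y ] v ~ y}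
  ... | yes (y , v~y) = v , y , v~y
  ... | no isolated   = ⊥-elim (infinite (_ , HasSize-resp-≐ ((λ _ → tt) , λ _ → only)
                                                (HasSize-singleton v)))
    where
    only : ∀ {x} → x ≡ v
    only {x} with connected v x
    ... | ε           = refl
    ... | v~y ◅ _     = ⊥-elim (isolated (_ , v~y))

  -- G stands for F^n with n ≥ 1, hence ψG for F^(n+1).
  module Subdivision {G : Pred V 0ℓ} (G⊆F : G ⊆ F) where

    ψG : Pred V 0ℓ
    ψG = image ψ G

    ψG⊆F : ψG ⊆ F
    ψG⊆F (_ , _ , refl) = ψ∈F

    ψ∉ψG : ∀ {x} → x ∉ G → ψ x ∉ ψG
    ψ∉ψG x∉G (_ , y∈G , eq) = x∉G (subst G (ψ-injective eq) y∈G)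

    ∉F⇒∉ψG : ∀ {x} → x ∉ F → x ∉ ψG
    ∉F⇒∉ψG x∉F = x∉F ∘ ψG⊆F

    cell⊆component : ∀ {v} → cell v ⊆ component X ψG v
    cell⊆component = Star-map λ (x∉F , y∉F , x~y) → ∉F⇒∉ψG x∉F , ∉F⇒∉ψG y∉F , x~y

    -- Removing only `ψG` keeps each cell in one piece, and a boundary vertex outside `ψG` is
    -- attached to it by an edge. Cells thus get glued along the vertices of `F` outside `ψG`.
    boundary⊆component : ∀ {v y} → v ∉ F → y ∈ θ X (cell v) → y ∉ ψG → y ∈ component X ψG v
    boundary⊆component v∉F (_ , _ , p , x~y) =
      component-extend X (∉F⇒∉ψG v∉F) (cell⊆component p) x~y

    module _ {u : V} (u∉G : u ∉ G) where

      ψ-component⁺ : ∀ {z} → z ∈ component X G u → ψ z ∈ component X ψG (ψ u)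
      ψ-component⁺ = go
        where
        go : ∀ {x z} → z ∈ component X G x → ψ z ∈ component X ψG (ψ x)
        go ε = ε
        go ((x∉G , y∉G , x~y) ◅ p) with ~⇒shared-cell x~y
        -- The edge from `x` to `y` becomes a detour from `ψ x` to `ψ y` through the cell that has
        -- both on its boundary.
        ... | _ , v , v∉F , ψx∈θ , ψy∈θ =
          component-sym X (boundary⊆component v∉F ψx∈θ (ψ∉ψG x∉G))
          ◅◅ boundary⊆component v∉F ψy∈θ (ψ∉ψG y∉G)
          ◅◅ go p

      -- Along a path avoiding ψG, the last vertex of F visited is ψ z with z ∈ component X G u.
      Traced : Pred V 0ℓ
      Traced x = ∃[ z ] z ∈ component X G u × (ψ z ≡ x ⊎ (x ∉ F × ψ z ∈ θ X (cell x)))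

      -- From a vertex of `F`, (F1) forces the step into a cell having that vertex on its boundary.
      -- From outside `F`, the step either stays in the same cell or returns to `F`.
      trace-step : ∀ {x y} → AdjacentOutside X ψG x y → x ∈ Traced → y ∈ Traced
      trace-step (_ , _ , x~y) (z , p , inj₁ refl) = z , p , inj₂
        ((λ y∈F → F1 ψ∈F y∈F x~y) ,
         component-boundary⁺ X (λ y∈F → F1 ψ∈F y∈F x~y) ε (~-sym x~y) ψ∈F)
      trace-step {x} {y} (_ , y∉ψG , x~y) (z , p , inj₂ (x∉F , ψz∈θ)) with em {y ∈ F}
      ... | no y∉F = z , p , inj₂
        (y∉F , θ-resp-≐ X (component-≐ X (component-extend X x∉F ε x~y y∉F)) ψz∈θ)
      ... | yes y∈F with surjective y∈F | em {ψ z ≡ y}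
      ...   | _              | yes ψz≡y = z , p , inj₁ ψz≡y
      -- The path returns to `F` at `ψ w`. As `ψ z` and `ψ w` bound the same cell, (F3) makes `z`
      -- and `w` adjacent, and `w` lies outside `G` because the path avoids `ψG`.
      ...   | w , _ , refl   | no  ψz≢ψw = w ,
        component-extend X u∉G p
          (shared-cell⇒~ x∉F ψz∈θ (component-boundary⁺ X x∉F ε x~y ψ∈F) ψz≢ψw)
          (λ w∈G → y∉ψG (w , w∈G , refl))
        , inj₁ refl

      traced : ∀ {x y} → y ∈ component X ψG x → x ∈ Traced → y ∈ Traced
      traced ε       t = t
      traced (s ◅ p) t = traced p (trace-step s t)

      -- Tracing a path that ends in `F` rules out the second alternative of `Traced`, so
      -- injectivity of `ψ` identifies the traced vertex with `z`.
      ψ-component⁻ : ∀ {z} → ψ z ∈ component X ψG (ψ u) → z ∈ component X G u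
      ψ-component⁻ p with traced p (u , ε , inj₁ refl)
      ... | w , q , inj₁ ψw≡ψz      = subst (component X G u) (ψ-injective ψw≡ψz) q
      ... | _ , _ , inj₂ (ψz∉F , _) = ⊥-elim (ψz∉F ψ∈F)

-- Passage to rational numbers.

-- Among unnormalised rationals equality is cross multiplication, which is the hypothesis up to
-- factors 1. Matching `d` as a successor lets the fractions compute.
/-scale : ∀ b d .{{_ : NonZero d}} {m k} → m ℕ.* d ≡ k ℕ.* b →
          (+ m) / 1 ≡ ((+ b) / d) * ((+ k) / 1)
/-scale b d@(suc d-1) {m} {k} eq = ℚ.toℚᵘ-injective (begin
  toℚᵘ ((+ m) / 1)                       ≈⟨ ℚ.toℚᵘ-fromℚᵘ ((+ m) ℚᵘ./ 1) ⟩
  (+ m) ℚᵘ./ 1                           ≈⟨ ℚᵘ.*≡* cross ⟩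
  ((+ b) ℚᵘ./ d) ℚᵘ.* ((+ k) ℚᵘ./ 1)     ≈⟨ ℚᵘ.*-cong (ℚ.toℚᵘ-fromℚᵘ ((+ b) ℚᵘ./ d))
                                                      (ℚ.toℚᵘ-fromℚᵘ ((+ k) ℚᵘ./ 1)) ⟨
  toℚᵘ ((+ b) / d) ℚᵘ.* toℚᵘ ((+ k) / 1) ≈⟨ ℚ.toℚᵘ-homo-* ((+ b) / d) ((+ k) / 1) ⟨
  toℚᵘ (((+ b) / d) * ((+ k) / 1))       ∎)
  where
  open ℚᵘ.≃-Reasoning
  cross : (+ m) ℤ.* (+ (d ℕ.* 1)) ≡ ((+ b) ℤ.* (+ k)) ℤ.* (+ 1)
  cross = trans (cong (λ c → (+ m) ℤ.* (+ c)) (ℕ.*-identityʳ d))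
    (trans (sym (ℤ.pos-* m d)) (trans (cong +_ (trans eq (ℕ.*-comm k b)))
      (trans (ℤ.pos-* b k) (sym (ℤ.*-identityʳ _)))))

/-scale-^ : ∀ b d .{{_ : NonZero d}} n (q : ℚ) {m k} → m ℕ.* d ≡ k ℕ.* b →
            (+ k) / 1 ≡ ((+ b) / d) ^ n * q → (+ m) / 1 ≡ ((+ b) / d) ^ suc n * q
/-scale-^ b d n q {m} {k} scaled ih = begin
  (+ m) / 1         ≡⟨ /-scale b d {m} {k} scaled ⟩
  r * ((+ k) / 1)   ≡⟨ cong (r *_) ih ⟩
  r * (r ^ n * q)   ≡⟨ ℚ.*-assoc r (r ^ n) q ⟨
  r ^ suc n * q     ∎
  where
  open ≡-Reasoning
  r = (+ b) / d

-- Homogeneity: sizes of cell boundaries and the double count.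

module Homogeneous (em : ExcludedMiddle 0ℓ) {X : Graph}
  {F : Pred (Graph.V X) 0ℓ} {ψ : Graph.V X → Graph.V X} (hss : IsHomogeneouslySelfSimilar X F ψ)
  {b : ℕ} (innerDegree : HasConstantInnerDegree X F b)
  {C : Pred (Graph.V X) 0ℓ} (C∈𝒞 : C ∈ 𝒞 X F) {θX : ℕ} (|θC| : HasSize (θ X C) θX) where

  open Graph X
  open IsHomogeneouslySelfSimilar hss
  open IsSelfSimilar selfSimilar
  open IsIsomorphism F3 using (surjective)
  open SelfSimilar em selfSimilar
  open Classical em

  |θ-cell| : ∀ {v} → v ∉ F → HasSize (θ X (cell v)) θX
  |θ-cell| v∉F with H1-iso (component-∈-𝒞 X v∉F) C∈𝒞
  ... | α , iso , image⊆ , ⊆image = HasSize-preimage α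
    (λ p → image⊆ (_ , p , refl))
    (λ p q → IsIsomorphism.injective iso (inj₂ p) (inj₂ q))
    ⊆image |θC|

  -- `ψ` sends the ends of any edge to two distinct boundary vertices of one cell, and all cells
  -- have equally many. This makes `θX ∸ 1` a legitimate denominator.
  2≤θX : 2 ≤ θX
  2≤θX with edge (proj₁ C∈𝒞)
  ... | _ , _ , x~y with ~⇒shared-cell x~y
  ...   | ψx≢ψy , _ , v∉F , ψx∈θ , ψy∈θ = two-elements⁻ (|θ-cell| v∉F) ψx∈θ ψy∈θ ψx≢ψy

  instance
    θX∸1-nonZero : NonZero (θX ∸ 1)
    θX∸1-nonZero = ℕ.>-nonZero (ℕ.∸-monoˡ-≤ 1 2≤θX)

  |inner-edges| : ∀ {v y} → v ∉ F → y ∈ θ X (cell v) →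
                  HasSize (λ x → x ∈ cell v × x ~ y) b
  |inner-edges| v∉F y∈θ = HasSize-resp-≐
    ( (λ { (_ , inj₁ x∈D , y~x) → x∈D , ~-sym y~x
         -- The inner degree counts neighbours in the closure, but by (F1) none of them is a
         -- boundary vertex.
         ; (_ , inj₂ x∈θ , y~x) → ⊥-elim (F1 (θ-cell⊆F v∉F y∈θ) (θ-cell⊆F v∉F x∈θ) y~x) })
    , (λ (x∈D , x~y) → inj₂ y∈θ , inj₁ x∈D , ~-sym x~y))
    (innerDegree (component-∈-𝒞 X v∉F) y∈θ)

  -- Edges are grouped by their outer endpoint, each boundary vertex receiving `b` of them. The
  -- count depends on no particular cell.
  |δ-cell| : ∀ {v} → v ∉ F → HasSize (δ X (cell v)) (θX ℕ.* b)
  |δ-cell| v∉F = HasSize-preimage swap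
    (λ (x∈D , y∉D , x~y) → (y∉D , _ , x∈D , x~y) , x∈D , x~y)
    (λ { _ _ refl → refl })
    (λ (y∈θ , x∈D , x~y) → _ , (x∈D , proj₁ y∈θ , x~y) , refl)
    (HasSize-Σ (|θ-cell| v∉F) (|inner-edges| v∉F))

  module _ {G : Pred V 0ℓ} (G⊆F : G ⊆ F) where
    open Subdivision G⊆F

    -- This allows every component outside `ψG` to be based at some `ψ u`. If `v` is not in `F`, its
    -- cell has two boundary vertices; their preimages are adjacent, so by (F1) not both lie in `G`.
    component-meets-F : ∀ {v} → v ∉ ψG → ∃[ u ] u ∉ G × ψ u ∈ component X ψG v
    component-meets-F {v} v∉ψG with em {v ∈ F}
    ... | yes v∈F with surjective v∈F
    ...   | u , _ , refl = u , (λ u∈G → v∉ψG (u , u∈G , refl)) , ε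
    component-meets-F {v} v∉ψG | no v∉F
      with two-elements (|θ-cell| v∉F) 2≤θX
    ... | _ , _ , x∈θ , y∈θ , x≢y
      with surjective (θ-cell⊆F v∉F x∈θ) | surjective (θ-cell⊆F v∉F y∈θ)
    ... | x , _ , refl | y , _ , refl with em {x ∈ G}
    ...   | no x∉G  = x , x∉G , boundary⊆component v∉F x∈θ (ψ∉ψG x∉G)
    ...   | yes x∈G = y , y∉G , boundary⊆component v∉F y∈θ (ψ∉ψG y∉G)
      where
      y∉G : y ∉ G
      y∉G y∈G = F1 (G⊆F x∈G) (G⊆F y∈G) (shared-cell⇒~ v∉F x∈θ y∈θ x≢y)

    module _ {u : V} (u∉G : u ∉ G) where
      private
        D E : Pred V 0ℓ
        D = component X G u
        E = component X ψG (ψ u)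

      -- Both edges determine a cell: (x , y) ∈ δ E that of x, with y on its boundary, and
      -- (w , z) ∈ δ D the one with ψ w and ψ z on its boundary. They are related when these
      -- cells agree and y ≡ ψ z.
      _⟷_ : V × V → V × V → Set
      (x , y) ⟷ (w , z) = (x , y) ∈ δ X E × (w , z) ∈ δ X D × y ≡ ψ z × ψ w ∈ θ X (cell x)

      ∈E⇒∉ψG : ∀ {x} → x ∈ E → x ∉ ψG
      ∈E⇒∉ψG = component-avoids X (ψ∉ψG u∉G)

      row : ∀ {e} → e ∈ δ X E → HasSize (e ⟷_) (θX ∸ 1)
      row {x , y} (x∈E , y∉E , x~y)
        -- The outer endpoint lies in `ψG`, so it is `ψ z` with `z` in `G`. The partners of
        -- `(x , y)` are then the `(w , z)` with `ψ w` on the boundary of the cell of `x` and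
        -- different from `y`.
        with component-boundary⁻ X em (ψ∉ψG u∉G) (y∉E , x , x∈E , x~y)
      ... | z , z∈G , refl = HasSize-preimage (ψ ∘ proj₁) maps′ inj surj
        (HasSize-remove y∈θ (|θ-cell| x∉F))
        where
        x∉F : x ∉ F
        x∉F x∈F = F1 x∈F ψ∈F x~y
        y∈θ : y ∈ θ X (cell x)
        y∈θ = component-boundary⁺ X x∉F ε x~y ψ∈F
        maps′ : ∀ {p} → (x , y) ⟷ p → ψ (proj₁ p) ∈ θ X (cell x) × ψ (proj₁ p) ≢ y
        maps′ (_ , (_ , _ , w~z) , y≡ψz , ψw∈θ) =
          ψw∈θ , λ ψw≡y → proj₁ (~⇒shared-cell w~z) (trans ψw≡y y≡ψz)
        inj : ∀ {p q} → (x , y) ⟷ p → (x , y) ⟷ q → ψ (proj₁ p) ≡ ψ (proj₁ q) → p ≡ q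
        inj (_ , _ , y≡ψz , _) (_ , _ , y≡ψz′ , _) eq =
          cong₂ _,_ (ψ-injective eq) (ψ-injective (trans (sym y≡ψz) y≡ψz′))
        surj : ∀ {a} → a ∈ θ X (cell x) × a ≢ y → ∃[ p ] (x , y) ⟷ p × ψ (proj₁ p) ≡ a
        surj (a∈θ , a≢y) with surjective (θ-cell⊆F x∉F a∈θ)
        ... | w , _ , refl = (w , z) ,
            ((x∈E , y∉E , x~y) , (w∈D , z∉D , w~z) , refl , a∈θ) , refl
          where
          w~z = shared-cell⇒~ x∉F a∈θ y∈θ a≢y
          w∉G : w ∉ G
          w∉G w∈G = F1 (G⊆F w∈G) (G⊆F z∈G) w~z
          w∈D : w ∈ D
          -- `ψ w` is joined to `x` through the cell of `x`, hence lies in `E`.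
          w∈D = ψ-component⁻ u∉G (x∈E ◅◅ boundary⊆component x∉F a∈θ (ψ∉ψG w∉G))
          z∉D : z ∉ D
          z∉D z∈D = component-avoids X u∉G z∈D z∈G

      column : ∀ {p} → p ∈ δ X D → HasSize (_⟷ p) b
      column {w , z} (w∈D , z∉D , w~z) with ~⇒shared-cell w~z
      ... | ψw≢ψz , v , v∉F , ψw∈θ , ψz∈θ =
        HasSize-preimage proj₁ maps′ inj surj (|inner-edges| v∉F ψz∈θ)
        where
        z∈G : z ∈ G
        z∈G = component-boundary⁻ X em u∉G (z∉D , w , w∈D , w~z)
        maps′ : ∀ {e} → e ⟷ (w , z) → proj₁ e ∈ cell v × proj₁ e ~ ψ z
        maps′ {x , _} ((_ , _ , x~y) , _ , refl , ψw∈θ′) = proj₂ same ε , x~y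
          where
          x∉F : x ∉ F
          x∉F x∈F = F1 x∈F ψ∈F x~y
          same : cell v ≐ cell x
          -- Here (F2) enters: `ψ w` and `ψ z` together determine the cell, so `x` must lie in
          -- `cell v`.
          same = shared-cell-unique v∉F x∉F ψw≢ψz ψw∈θ ψz∈θ ψw∈θ′
                   (component-boundary⁺ X x∉F ε x~y ψ∈F)
        inj : ∀ {e f} → e ⟷ (w , z) → f ⟷ (w , z) → proj₁ e ≡ proj₁ f → e ≡ f
        inj (_ , _ , y≡ψz , _) (_ , _ , y′≡ψz , _) eq = cong₂ _,_ eq (trans y≡ψz (sym y′≡ψz))
        surj : ∀ {x} → x ∈ cell v × x ~ ψ z → ∃[ e ] e ⟷ (w , z) × proj₁ e ≡ x
        surj {x} (x∈cell , x~ψz) = (x , ψ z) ,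
          ( (x∈E , (λ ψz∈E → ∈E⇒∉ψG ψz∈E (z , z∈G , refl)) , x~ψz)
          , (w∈D , z∉D , w~z) , refl , ψw∈θ′) , refl
          where
          x∉F : x ∉ F
          x∉F = component-avoids X v∉F x∈cell
          ψw∈θ′ : ψ w ∈ θ X (cell x)
          ψw∈θ′ = θ-resp-≐ X (component-≐ X x∈cell) ψw∈θ
          x∈E : x ∈ E
          -- The path runs from `ψ u` to `ψ w` and from there into the cell of `x`.
          x∈E = ψ-component⁺ u∉G w∈D ◅◅ component-sym X
            (boundary⊆component x∉F ψw∈θ′ (ψ∉ψG (component-avoids X u∉G w∈D)))

      |δ|-step : ∀ {k} → HasSize (δ X D) k → ∃[ m ] HasSize (δ X E) m × m ℕ.* (θX ∸ 1) ≡ k ℕ.* b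
      |δ|-step = doubleCount _⟷_ (λ (e∈δE , p∈δD , _) → e∈δE , p∈δD) row column

  -- Induction on the level of the cell.

  module _ {δX : ℕ} (|δC| : HasSize (δ X C) δX) where

    -- Both `C` and `cell v` have `θX * b` boundary edges.
    |δ-cell|≡δX : ∀ {v} → v ∉ F → HasSize (δ X (cell v)) δX
    |δ-cell|≡δX v∉F = subst (HasSize _) (HasSize-unique
      (|δ-cell| (proj₁ (proj₂ C∈𝒞)))
      (HasSize-resp-≐ (δ-resp-≐ X (proj₂ (proj₂ C∈𝒞))) |δC|)) (|δ-cell| v∉F)

    iterImage⊆F : ∀ m → iterImage X ψ (suc m) ⊆ F
    iterImage⊆F m (_ , _ , refl) = ψ∈F

    F⊆image : F ⊆ iterImage X ψ 1
    F⊆image y∈F with surjective y∈F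
    ... | x , _ , eq = x , tt , eq

    -- The level is `suc m`, so the exponent is `m`. Finiteness of the edge boundary is carried
    -- along the induction, since `|δ|-step` takes an enumeration at one level and yields one at the
    -- next.
    |δ-nCell| : ∀ m {v} → v ∉ iterImage X ψ (suc m) →
      ∃[ k ] HasSize (δ X (component X (iterImage X ψ (suc m)) v)) k ×
             (+ k) / 1 ≡ ((+ b) / (θX ∸ 1)) ^ m * ((+ δX) / 1)
    |δ-nCell| zero v∉ =
      δX ,
      -- The first iterated image equals `F` only extensionally, so components are transported.
      HasSize-resp-≐ (δ-resp-≐ X (component-cong X (F⊆image , iterImage⊆F 0)))
        (|δ-cell|≡δX (v∉ ∘ F⊆image)) ,
      sym (ℚ.*-identityˡ ((+ δX) / 1))
    |δ-nCell| (suc m) v∉ =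
      let u , u∉ , ψu∈     = component-meets-F (iterImage⊆F m) v∉
          k , |δ| , eq     = |δ-nCell| m u∉
          k′ , |δ′| , k′≡  = |δ|-step (iterImage⊆F m) u∉ |δ|
      in k′ ,
         HasSize-resp-≐ (δ-resp-≐ X (swap (component-≐ X ψu∈))) |δ′| ,
         /-scale-^ b (θX ∸ 1) m ((+ δX) / 1) {k′} {k} k′≡ eq

theorem2 : ExcludedMiddle 0ℓ →
    (X : Graph) (F : Pred (Graph.V X) 0ℓ) (ψ : Graph.V X → Graph.V X) →
    IsHomogeneouslySelfSimilar X F ψ →
    (b : ℕ) → HasConstantInnerDegree X F b →
    (C : Pred (Graph.V X) 0ℓ) → C ∈ 𝒞 X F →
    (θX δX : ℕ) → HasSize (θ X C) θX → HasSize (δ X C) δX →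
    (n : ℕ) → 1 ≤ n →
    (Cₙ : Pred (Graph.V X) 0ℓ) → Cₙ ∈ IsNCell X ψ n →
    ∃[ k ] HasSize (δ X Cₙ) k ×
    (Σ[ nz ∈ NonZero (θX ∸ 1) ]
    (+ k) / 1 ≡ (_/_ (+ b) (θX ∸ 1) {{nz}}) ^ (n ∸ 1) * ((+ δX) / 1))
theorem2 em X F ψ hss b innerDegree C C∈𝒞 θX δX |θC| |δC| (suc n) _ Cₙ (v , v∉ , Cₙ≐) =
  let k , |δ| , eq = |δ-nCell| |δC| n v∉
  in k , HasSize-resp-≐ (swap (δ-resp-≐ X Cₙ≐)) |δ| , θX∸1-nonZero , eq
  where open Homogeneous em hss innerDegree C∈𝒞 |θC|
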